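{- Let $G=(V,E)$ be an undirected, connected graph with $|V|=n$ and $|E|\ge n$. Then there exists a graph $\tilde G=(\tilde V,\tilde E)$ with $|\tilde V|=2n$ such that any algorithm given access to either $\mathcal{O}^\pi(G)$ or $\mathcal{O}^\pi(\tilde G)$, each chosen with equal probability, cannot distinguish between the two with probability greater than $2/3$ unless it makes at least $\Omega\left(\frac{1}{\|\pi_G\|_2}\right)$ queries. As a consequence, no algorithm can output $\hat n$ satisfying $|\hat n-n^*|<n^*/2$ with probability at least $2/3$, where $n^*=n$ if the chosen graph is $G$ and $n^*=2n$ if it is $\tilde G$.
   Context: For a connected undirected graph $H$, $\pi_H$ denotes the stationary distribution of the lazy random walk on $H$ (stay with probability $1/2$, otherwise move to a uniformly random neighbour), namely $\pi_H(u)=\deg_H(u)/(2|E(H)|)$; $\|\pi_H\|_2=(\sum_u\pi_H(u)^2)^{1/2}$. The stationary query oracle $\mathcal{O}^\pi(H)$: each query returns $(\ell(v),\deg_H(v))$ where $v$ is drawn independently from $\pi_H$ and $\ell$ is the consecutive labelling (the first time a node is returned it receives the smallest natural number not yet used as a label; thereafter it keeps that label). Each query costs one unit. -}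

module Defs where

open import Data.Nat as ℕ using (ℕ; zero; suc)
open import Data.Fin using (Fin; _≟_)
open import Data.Bool using (Bool; true; false; T)
open import Data.Maybe using (Maybe; just; nothing)
open import Data.List using (List; []; _∷_; _++_; length; map; concatMap; allFin; zip)
open import Data.Integer using (+_)
open import Data.Rational as ℚ using (ℚ; 0ℚ; 1ℚ)
open import Data.Product using (_×_; _,_)
open import Relation.Binary.PropositionalEquality using (_≡_)
open import Relation.Nullary using (yes; no)

record Graph (n : ℕ) : Set where
  field
    adj    : Fin n → Fin n → Bool
    sym    : ∀ u v → adj u v ≡ adj v u
    irrefl : ∀ u → adj u u ≡ false
open Graph public

count : List Bool → ℕ
count []           = 0
count (true ∷ bs)  = suc (count bs)
count (false ∷ bs) = count bs

sumℕ : List ℕ → ℕ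
sumℕ []       = 0
sumℕ (x ∷ xs) = x ℕ.+ sumℕ xs

sumℚ : List ℚ → ℚ
sumℚ []       = 0ℚ
sumℚ (x ∷ xs) = x ℚ.+ sumℚ xs

prodℚ : List ℚ → ℚ
prodℚ []       = 1ℚ
prodℚ (x ∷ xs) = x ℚ.* prodℚ xs

fromℕ : ℕ → ℚ
fromℕ k = (+ k) ℚ./ 1

-- a / b as a rational; convention: 0 when b = 0 (never used in a relevant case)
divℕ : ℕ → ℕ → ℚ
divℕ a zero    = 0ℚ
divℕ a (suc b) = (+ a) ℚ./ suc b

deg : ∀ {n} → Graph n → Fin n → ℕ
deg {n} G u = count (map (adj G u) (allFin n))

twoE : ∀ {n} → Graph n → ℕ
twoE {n} G = sumℕ (map (deg G) (allFin n))

-- sum of squared degrees; ‖π_G‖₂² = sumSqDeg G / (twoE G)²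
sumSqDeg : ∀ {n} → Graph n → ℕ
sumSqDeg {n} G = sumℕ (map (λ u → deg G u ℕ.* deg G u) (allFin n))

data Walk {n} (G : Graph n) : Fin n → Fin n → Set where
  here : ∀ {u} → Walk G u u
  step : ∀ {u v w} → T (adj G u v) → Walk G v w → Walk G u w

Connected : ∀ {n} → Graph n → Set
Connected {n} G = ∀ (u v : Fin n) → Walk G u v

πG : ∀ {n} → Graph n → Fin n → ℚ
πG G u = divℕ (deg G u) (twoE G)

seqs : (n q : ℕ) → List (List (Fin n))
seqs n zero    = [] ∷ []
seqs n (suc q) = concatMap (λ v → map (v ∷_) (seqs n q)) (allFin n)

indexOf : ∀ {n} → Fin n → List (Fin n) → Maybe ℕ
indexOf v [] = nothing
indexOf v (w ∷ ws) with v ≟ w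
... | yes _ = just 0
... | no _ with indexOf v ws
...   | just i  = just (suc i)
...   | nothing = nothing

-- consecutive labelling, given the list of already-seen vertices (in order of first appearance)
labels : ∀ {n} → List (Fin n) → List (Fin n) → List ℕ
labels seen [] = []
labels seen (v ∷ vs) with indexOf v seen
... | just i  = i ∷ labels seen vs
... | nothing = length seen ∷ labels (seen ++ (v ∷ [])) vs

-- the transcript of answers (ℓ(v), deg(v)) of the oracle for the sampled vertex sequence
Transcript : Set
Transcript = List (ℕ × ℕ)

transcript : ∀ {n} → Graph n → List (Fin n) → Transcript
transcript G s = zip (labels [] s) (map (deg G) s)

-- probability under O^π(G) that q queries sample the vertex sequence s
seqProb : ∀ {n} → Graph n → List (Fin n) → ℚ
seqProb G s = prodℚ (map (πG G) s)

-- A randomized q-query algorithm is a map from transcripts to the probability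
-- (in [0,1]) that it answers "the oracle is O^π(G̃)".
ValidAlg : (Transcript → ℚ) → Set
ValidAlg A = ∀ t → (0ℚ ℚ.≤ A t) × (A t ℚ.≤ 1ℚ)

acceptProb : ∀ {n} → Graph n → ℕ → (Transcript → ℚ) → ℚ
acceptProb {n} H q A = sumℚ (map (λ s → seqProb H s ℚ.* A (transcript H s)) (seqs n q))

successProb : ∀ {n m} → Graph n → Graph m → ℕ → (Transcript → ℚ) → ℚ
successProb G G~ q A =
  ((+ 1) ℚ./ 2) ℚ.* ((1ℚ ℚ.- acceptProb G q A) ℚ.+ acceptProb G~ q A)

{-# OPTIONS --safe #-}
module Submission where

-- G̃ is two copies of G joined by a single edge between the two copies of vertex 0.
-- The projection G̃ → G pushes πG̃ forward to ν(v) = (deg v + [v = 0]) / (2|E| + 1),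
-- and away from the bridge endpoints πG̃ is dominated by ½ πG ∘ projection, which
-- pushes forward exactly to πG.  If the projected sample neither hits 0 nor repeats
-- a vertex, every queried vertex is new and has the same degree in G and G̃, so both
-- oracles give the same transcript.  Coupling the two oracles through the projection
-- thus changes any algorithm's acceptance probability by at most the probability of
-- that event, which is ≤ q ν(0) + q² Σ ν² by a union bound; for q < 1 / (8 ‖πG‖₂)
-- this is at most 1/4 + 1/12 = 1/3.

open import Defs hiding (sym)
open import Data.Nat using (ℕ; zero; suc; _+_; _*_; _≤_; _<_; z≤n; s≤s)
import Data.Nat.Properties as ℕP
open import Data.Nat.Tactic.RingSolver using (solve-∀)
import Data.Integer.Tactic.RingSolver as ℤSolver
open import Data.Integer as ℤ using (+_)
import Data.Integer.Properties as ℤP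
open import Data.Rational as ℚ using (ℚ; 0ℚ; 1ℚ; ½; _/_; toℚᵘ)
  renaming (_<_ to _<ℚ_; _≤_ to _≤ℚ_; _+_ to _+ℚ_; _-_ to _-ℚ_; _*_ to _*ℚ_)
import Data.Rational.Properties as ℚP
open import Algebra.Bundles using (CommutativeMonoid)
open import Algebra.Properties.CommutativeSemigroup (CommutativeMonoid.commutativeSemigroup ℚP.+-0-commutativeMonoid)
  using () renaming (interchange to +-interchange)
open import Algebra.Properties.CommutativeSemigroup (CommutativeMonoid.commutativeSemigroup ℚP.*-1-commutativeMonoid)
  using () renaming (x∙yz≈y∙xz to *-left-swap)
open import Data.Rational.Unnormalised as ℚᵘ using (mkℚᵘ; *≡*; *≤*; *<*)
import Data.Rational.Unnormalised.Properties as ℚᵘP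
open import Data.Bool using (Bool; true; false; _∨_; T; if_then_else_)
open import Data.Empty using (⊥-elim)
open import Data.Fin as Fin using (Fin; zero; suc; _↑ˡ_; _↑ʳ_; combine; remQuot)
open import Data.Fin.Properties using (remQuot-combine; combine-remQuot)
open import Data.List using (List; []; _∷_; _++_; _∷ʳ_; map; allFin; concatMap; tabulate; length; zip)
open import Data.List.Properties
  using (map-cong; map-cong-local; map-∘; map-++; map-tabulate; ++-identityʳ; length-++; length-map)
open import Data.List.Membership.Propositional using (_∉_)
open import Data.List.Membership.Propositional.Properties using (∈-++⁻)
open import Data.List.Relation.Unary.All as All using (All; []; _∷_)
import Data.List.Relation.Unary.All.Properties as All
open import Data.List.Relation.Unary.AllPairs using ([]; _∷_)
open import Data.List.Relation.Unary.Any using (here; there)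
open import Data.List.Relation.Unary.Unique.Propositional using (Unique)
import Data.List.Relation.Unary.Unique.Propositional.Properties as Unique
open import Data.Maybe using (nothing)
open import Data.Product using (Σ; _×_; _,_; proj₁; proj₂)
open import Data.Sum using (inj₁; inj₂)
open import Function using (_∘_)
open import Relation.Binary.PropositionalEquality
open import Relation.Nullary using (¬_; Dec; yes; no)
open import Relation.Nullary.Decidable using (does)

-- divℕ a (suc b) is fromℚᵘ (mkℚᵘ (+ a) b) by definition, so identities and
-- inequalities between such fractions reduce to cross-multiplication in ℕ.
toℚᵘ-divℕ : ∀ a b → toℚᵘ (divℕ a (suc b)) ℚᵘ.≃ mkℚᵘ (+ a) b
toℚᵘ-divℕ a b = ℚP.toℚᵘ-fromℚᵘ (mkℚᵘ (+ a) b)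

≡-divℕ : ∀ {p} a b → toℚᵘ p ℚᵘ.≃ mkℚᵘ (+ a) b → p ≡ divℕ a (suc b)
≡-divℕ a b p≃ = ℚP.toℚᵘ-injective (ℚᵘP.≃-trans p≃ (ℚᵘP.≃-sym (toℚᵘ-divℕ a b)))

divℕ-cong : ∀ {a b c d} → a * suc d ≡ c * suc b → divℕ a (suc b) ≡ divℕ c (suc d)
divℕ-cong {a} {b} {c} {d} eq = ℚP.fromℚᵘ-cong (*≡* {mkℚᵘ (+ a) b} {mkℚᵘ (+ c) d}
  (trans (sym (ℤP.pos-* a (suc d))) (trans (cong +_ eq) (ℤP.pos-* c (suc b)))))

divℕ-mono-≤ : ∀ {a b c d} → a * suc d ≤ c * suc b → divℕ a (suc b) ≤ℚ divℕ c (suc d)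
divℕ-mono-≤ {a} {b} {c} {d} le = ℚP.toℚᵘ-cancel-≤
  (ℚᵘP.≤-respˡ-≃ (ℚᵘP.≃-sym (toℚᵘ-divℕ a b)) (ℚᵘP.≤-respʳ-≃ (ℚᵘP.≃-sym (toℚᵘ-divℕ c d))
    (*≤* (subst₂ ℤ._≤_ (ℤP.pos-* a (suc d)) (ℤP.pos-* c (suc b)) (ℤ.+≤+ le)))))

divℕ-cancel-< : ∀ {a b c d} → divℕ a (suc b) <ℚ divℕ c (suc d) → a * suc d < c * suc b
divℕ-cancel-< {a} {b} {c} {d} lt
  with ℚᵘP.<-respˡ-≃ (toℚᵘ-divℕ a b) (ℚᵘP.<-respʳ-≃ (toℚᵘ-divℕ c d) (ℚP.toℚᵘ-mono-< lt))
... | *<* lt′ = ℤP.drop‿+<+ (subst₂ ℤ._<_ (sym (ℤP.pos-* a (suc d))) (sym (ℤP.pos-* c (suc b))) lt′)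

divℕ-* : ∀ a b c d → divℕ a (suc b) *ℚ divℕ c (suc d) ≡ divℕ (a * c) (suc b * suc d)
divℕ-* a b c d = ≡-divℕ (a * c) (d + b * suc d)
  (ℚᵘP.≃-trans (ℚP.toℚᵘ-homo-* (divℕ a (suc b)) (divℕ c (suc d)))
  (ℚᵘP.≃-trans (ℚᵘP.*-cong (toℚᵘ-divℕ a b) (toℚᵘ-divℕ c d))
    (*≡* (cong (ℤ._* + suc (d + b * suc d)) (sym (ℤP.pos-* a c))))))

divℕ-+ : ∀ a c b → divℕ a (suc b) +ℚ divℕ c (suc b) ≡ divℕ (a + c) (suc b)
divℕ-+ a c b = ≡-divℕ (a + c) b (ℚᵘP.≃-trans (ℚP.toℚᵘ-homo-+ (divℕ a (suc b)) (divℕ c (suc b)))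
  (ℚᵘP.≃-trans (ℚᵘP.+-cong (toℚᵘ-divℕ a b) (toℚᵘ-divℕ c b)) (*≡* (ring (+ a) (+ c) (+ suc b)))))
  where
  ring : ∀ x y z → (x ℤ.* z ℤ.+ y ℤ.* z) ℤ.* z ≡ (x ℤ.+ y) ℤ.* (z ℤ.* z)
  ring = ℤSolver.solve-∀

divℕ-zero : ∀ b → divℕ 0 (suc b) ≡ 0ℚ
divℕ-zero b = divℕ-cong {0} {b} {0} {0} refl

divℕ-self : ∀ b → divℕ (suc b) (suc b) ≡ 1ℚ
divℕ-self b = divℕ-cong {suc b} {b} {1} {0} (ℕP.*-comm (suc b) 1)

divℕ-nonNeg : ∀ a d → 0ℚ ≤ℚ divℕ a d
divℕ-nonNeg a zero    = ℚP.≤-refl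
divℕ-nonNeg a (suc b) = divℕ-mono-≤ {0} {0} {a} {b} z≤n

fromℕ-+ : ∀ a b → fromℕ a +ℚ fromℕ b ≡ fromℕ (a + b)
fromℕ-+ a b = divℕ-+ a b 0

fromℕ-*-divℕ : ∀ a c b → fromℕ a *ℚ divℕ c (suc b) ≡ divℕ (a * c) (suc b)
fromℕ-*-divℕ a c b =
  trans (divℕ-* a 0 c b) (divℕ-cong {a * c} {b + 0 * suc b} {a * c} {b} (one-times (a * c) b))
  where
  one-times : ∀ x b → x * suc b ≡ x * (1 * suc b)
  one-times = solve-∀

fromℕ-mono-≤ : ∀ {a b} → a ≤ b → fromℕ a ≤ℚ fromℕ b
fromℕ-mono-≤ {a} {b} a≤b = divℕ-mono-≤ {a} {0} {b} {0} (ℕP.*-monoˡ-≤ 1 a≤b)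

*-nonNeg : ∀ {p q} → 0ℚ ≤ℚ p → 0ℚ ≤ℚ q → 0ℚ ≤ℚ p *ℚ q
*-nonNeg {p} {q} 0≤p 0≤q = ℚP.nonNegative⁻¹ (p *ℚ q)
  {{ℚP.nonNeg*nonNeg⇒nonNeg p {{ℚ.nonNegative 0≤p}} q {{ℚ.nonNegative 0≤q}}}}

*-monoˡ-≤ : ∀ {r p q} → 0ℚ ≤ℚ r → p ≤ℚ q → r *ℚ p ≤ℚ r *ℚ q
*-monoˡ-≤ {r} 0≤r = ℚP.*-monoˡ-≤-nonNeg r {{ℚ.nonNegative 0≤r}}

*-monoʳ-≤ : ∀ {r p q} → 0ℚ ≤ℚ r → p ≤ℚ q → p *ℚ r ≤ℚ q *ℚ r
*-monoʳ-≤ {r} 0≤r = ℚP.*-monoʳ-≤-nonNeg r {{ℚ.nonNegative 0≤r}}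

m≤m*m : ∀ m → m ≤ m * m
m≤m*m zero    = z≤n
m≤m*m (suc m) = ℕP.m≤m*n (suc m) (suc m)

sumℚ-++ : ∀ xs ys → sumℚ (xs ++ ys) ≡ sumℚ xs +ℚ sumℚ ys
sumℚ-++ []       ys = sym (ℚP.+-identityˡ _)
sumℚ-++ (x ∷ xs) ys = trans (cong (x +ℚ_) (sumℚ-++ xs ys)) (sym (ℚP.+-assoc x _ _))

sumℕ-++ : ∀ xs ys → sumℕ (xs ++ ys) ≡ sumℕ xs + sumℕ ys
sumℕ-++ []       ys = refl
sumℕ-++ (x ∷ xs) ys = trans (cong (_+_ x) (sumℕ-++ xs ys)) (sym (ℕP.+-assoc x _ _))

count-++ : ∀ xs ys → count (xs ++ ys) ≡ count xs + count ys
count-++ []           ys = refl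
count-++ (true ∷ xs)  ys = cong suc (count-++ xs ys)
count-++ (false ∷ xs) ys = count-++ xs ys

count-false : ∀ {A : Set} (xs : List A) → count (map (λ _ → false) xs) ≡ 0
count-false []       = refl
count-false (x ∷ xs) = count-false xs

sumℕ-mono : ∀ {A : Set} {f g : A → ℕ} → (∀ x → f x ≤ g x) → ∀ xs → sumℕ (map f xs) ≤ sumℕ (map g xs)
sumℕ-mono f≤g []       = z≤n
sumℕ-mono f≤g (x ∷ xs) = ℕP.+-mono-≤ (f≤g x) (sumℕ-mono f≤g xs)

twoE≤sumSqDeg : ∀ {n} (H : Graph n) → twoE H ≤ sumSqDeg H
twoE≤sumSqDeg {n} H = sumℕ-mono (λ u → m≤m*m (deg H u)) (allFin n)

-- copy i v is the vertex v of the i-th of two copies of Fin n.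
copy : ∀ {n} → Fin 2 → Fin n → Fin (2 * n)
copy = combine

module _ {A : Set} where

  map-allFin-suc : ∀ {m} (f : Fin (suc m) → A) →
                   map f (allFin (suc m)) ≡ f zero ∷ map (f ∘ suc) (allFin m)
  map-allFin-suc f =
    cong (f zero ∷_) (trans (map-tabulate suc f) (sym (map-tabulate (λ i → i) (f ∘ suc))))

  map-allFin-+ : ∀ m {n} (f : Fin (m + n) → A) →
                 map f (allFin (m + n)) ≡ map (f ∘ (_↑ˡ n)) (allFin m) ++ map (f ∘ (m ↑ʳ_)) (allFin n)
  map-allFin-+ zero    f = refl
  map-allFin-+ (suc m) {n} f = trans (map-allFin-suc f)
    (trans (cong (f zero ∷_) (map-allFin-+ m (f ∘ suc)))
           (cong (_++ map (f ∘ (suc m ↑ʳ_)) (allFin n)) (sym (map-allFin-suc (f ∘ (_↑ˡ n))))))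

  map-allFin-copy : ∀ n (f : Fin (2 * n) → A) →
    map f (allFin (2 * n)) ≡ map (f ∘ copy zero) (allFin n) ++ map (f ∘ copy (suc zero)) (allFin n)
  map-allFin-copy n f = trans (map-allFin-+ n f)
    (cong (map (f ∘ copy zero) (allFin n) ++_) (trans (map-allFin-+ n (f ∘ (n ↑ʳ_))) (++-identityʳ _)))

count-copy : ∀ n (f : Fin (2 * n) → Bool) →
  count (map f (allFin (2 * n))) ≡ count (map (f ∘ copy zero) (allFin n)) + count (map (f ∘ copy (suc zero)) (allFin n))
count-copy n f = trans (cong count (map-allFin-copy n f)) (count-++ (map (f ∘ copy zero) (allFin n)) _)

sumℕ-copy : ∀ n (f : Fin (2 * n) → ℕ) →
  sumℕ (map f (allFin (2 * n))) ≡ sumℕ (map (f ∘ copy zero) (allFin n)) + sumℕ (map (f ∘ copy (suc zero)) (allFin n))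
sumℕ-copy n f = trans (cong sumℕ (map-allFin-copy n f)) (sumℕ-++ (map (f ∘ copy zero) (allFin n)) _)

∑ₗ : ∀ {A : Set} → (A → ℚ) → List A → ℚ
∑ₗ f xs = sumℚ (map f xs)

∑ : ∀ {m} → (Fin m → ℚ) → ℚ
∑ {m} f = ∑ₗ f (allFin m)

module _ {A : Set} where

  ∑ₗ-cong : ∀ {f g : A → ℚ} → (∀ x → f x ≡ g x) → ∀ xs → ∑ₗ f xs ≡ ∑ₗ g xs
  ∑ₗ-cong f≗g xs = cong sumℚ (map-cong f≗g xs)

  ∑ₗ-mono : ∀ {f g : A → ℚ} → (∀ x → f x ≤ℚ g x) → ∀ xs → ∑ₗ f xs ≤ℚ ∑ₗ g xs
  ∑ₗ-mono f≤g []       = ℚP.≤-refl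
  ∑ₗ-mono f≤g (x ∷ xs) = ℚP.+-mono-≤ (f≤g x) (∑ₗ-mono f≤g xs)

  ∑ₗ-+ : ∀ (f g : A → ℚ) xs → ∑ₗ (λ x → f x +ℚ g x) xs ≡ ∑ₗ f xs +ℚ ∑ₗ g xs
  ∑ₗ-+ f g []       = refl
  ∑ₗ-+ f g (x ∷ xs) = trans (cong (f x +ℚ g x +ℚ_) (∑ₗ-+ f g xs)) (+-interchange (f x) (g x) _ _)

  ∑ₗ-*ˡ : ∀ c (f : A → ℚ) xs → ∑ₗ (λ x → c *ℚ f x) xs ≡ c *ℚ ∑ₗ f xs
  ∑ₗ-*ˡ c f []       = sym (ℚP.*-zeroʳ c)
  ∑ₗ-*ˡ c f (x ∷ xs) = trans (cong (c *ℚ f x +ℚ_) (∑ₗ-*ˡ c f xs)) (sym (ℚP.*-distribˡ-+ c (f x) _))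

  ∑ₗ-*ʳ : ∀ c (f : A → ℚ) xs → ∑ₗ (λ x → f x *ℚ c) xs ≡ ∑ₗ f xs *ℚ c
  ∑ₗ-*ʳ c f xs = trans (∑ₗ-cong (λ x → ℚP.*-comm (f x) c) xs) (trans (∑ₗ-*ˡ c f xs) (ℚP.*-comm c _))

  ∑ₗ-divℕ : ∀ (f : A → ℕ) b xs → ∑ₗ (λ x → divℕ (f x) (suc b)) xs ≡ divℕ (sumℕ (map f xs)) (suc b)
  ∑ₗ-divℕ f b []       = sym (divℕ-zero b)
  ∑ₗ-divℕ f b (x ∷ xs) = trans (cong (divℕ (f x) (suc b) +ℚ_) (∑ₗ-divℕ f b xs)) (divℕ-+ (f x) _ b)

∑ₗ-map : ∀ {A B : Set} (f : B → ℚ) (h : A → B) xs → ∑ₗ f (map h xs) ≡ ∑ₗ (f ∘ h) xs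
∑ₗ-map f h xs = cong sumℚ (sym (map-∘ xs))

∑ₗ-concatMap : ∀ {A B : Set} (f : B → ℚ) (h : A → List B) xs →
               ∑ₗ f (concatMap h xs) ≡ ∑ₗ (λ x → ∑ₗ f (h x)) xs
∑ₗ-concatMap f h []       = refl
∑ₗ-concatMap f h (x ∷ xs) = trans (cong sumℚ (map-++ f (h x) _))
  (trans (sumℚ-++ (map f (h x)) _) (cong (∑ₗ f (h x) +ℚ_) (∑ₗ-concatMap f h xs)))

∑-suc : ∀ {m} (f : Fin (suc m) → ℚ) → ∑ f ≡ f zero +ℚ ∑ (f ∘ suc)
∑-suc f = cong sumℚ (map-allFin-suc f)

∑-copy : ∀ {n} (f : Fin (2 * n) → ℚ) → ∑ f ≡ ∑ {n} (f ∘ copy zero) +ℚ ∑ {n} (f ∘ copy (suc zero))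
∑-copy {n} f = trans (cong sumℚ (map-allFin-copy n f)) (sumℚ-++ (map (f ∘ copy zero) (allFin n)) _)

∑-*0 : ∀ {m} (f : Fin m → ℚ) → ∑ (λ x → f x *ℚ 0ℚ) ≡ 0ℚ
∑-*0 {m} f = trans (∑ₗ-*ʳ 0ℚ f (allFin m)) (ℚP.*-zeroʳ (∑ f))

ind : Bool → ℚ
ind b = if b then 1ℚ else 0ℚ

ind-∨ : ∀ a b → ind (a ∨ b) ≤ℚ ind a +ℚ ind b
ind-∨ true  true  = ℚ.*≤* (ℤ.+≤+ (s≤s z≤n))
ind-∨ true  false = ℚP.≤-refl
ind-∨ false b     = ℚP.≤-reflexive (sym (ℚP.+-identityˡ (ind b)))

∑-δ : ∀ {m} (f : Fin m → ℚ) y → ∑ (λ x → f x *ℚ ind (does (x Fin.≟ y))) ≡ f y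
∑-δ {suc m} f zero    = trans (∑-suc (λ x → f x *ℚ ind (does (x Fin.≟ zero))))
  (trans (cong₂ _+ℚ_ (ℚP.*-identityʳ (f zero)) (∑-*0 (f ∘ suc))) (ℚP.+-identityʳ (f zero)))
∑-δ {suc m} f (suc y) = trans (∑-suc (λ x → f x *ℚ ind (does (x Fin.≟ suc y))))
  (trans (cong₂ _+ℚ_ (ℚP.*-zeroʳ (f zero)) (∑-δ (f ∘ suc) y)) (ℚP.+-identityˡ (f (suc y))))

-- Independent samples

-- acceptProb H q A is 𝔼 (πG H) q (A ∘ transcript H) by definition.
𝔼 : ∀ {m} → (Fin m → ℚ) → ℕ → (List (Fin m) → ℚ) → ℚ
𝔼 {m} w q F = ∑ₗ (λ s → prodℚ (map w s) *ℚ F s) (seqs m q)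

module _ {m} (w : Fin m → ℚ) where

  𝔼-zero : ∀ F → 𝔼 w 0 F ≡ F []
  𝔼-zero F = trans (ℚP.+-identityʳ _) (ℚP.*-identityˡ (F []))

  𝔼-suc : ∀ q F → 𝔼 w (suc q) F ≡ ∑ (λ v → w v *ℚ 𝔼 w q (λ s → F (v ∷ s)))
  𝔼-suc q F =
    trans (∑ₗ-concatMap _ (λ v → map (v ∷_) (seqs m q)) (allFin m)) (∑ₗ-cong sample-first (allFin m))
    where
    sample-first : ∀ v → ∑ₗ (λ s → prodℚ (map w s) *ℚ F s) (map (v ∷_) (seqs m q)) ≡
                         w v *ℚ 𝔼 w q (λ s → F (v ∷ s))
    sample-first v = trans (∑ₗ-map _ (v ∷_) (seqs m q))
      (trans (∑ₗ-cong (λ s → ℚP.*-assoc (w v) (prodℚ (map w s)) (F (v ∷ s))) (seqs m q))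
             (∑ₗ-*ˡ (w v) (λ s → prodℚ (map w s) *ℚ F (v ∷ s)) (seqs m q)))

  𝔼-+ : ∀ q F G → 𝔼 w q (λ s → F s +ℚ G s) ≡ 𝔼 w q F +ℚ 𝔼 w q G
  𝔼-+ q F G = trans (∑ₗ-cong (λ s → ℚP.*-distribˡ-+ (prodℚ (map w s)) (F s) (G s)) (seqs m q))
    (∑ₗ-+ (λ s → prodℚ (map w s) *ℚ F s) (λ s → prodℚ (map w s) *ℚ G s) (seqs m q))

  𝔼-const : ∑ w ≡ 1ℚ → ∀ q c → 𝔼 w q (λ _ → c) ≡ c
  𝔼-const ∑w≡1 zero    c = 𝔼-zero (λ _ → c)
  𝔼-const ∑w≡1 (suc q) c = begin
    𝔼 w (suc q) (λ _ → c)            ≡⟨ 𝔼-suc q (λ _ → c) ⟩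
    ∑ (λ v → w v *ℚ 𝔼 w q (λ _ → c)) ≡⟨ ∑ₗ-cong (λ v → cong (w v *ℚ_) (𝔼-const ∑w≡1 q c)) (allFin m) ⟩
    ∑ (λ v → w v *ℚ c)               ≡⟨ ∑ₗ-*ʳ c w (allFin m) ⟩
    ∑ w *ℚ c                         ≡⟨ cong (_*ℚ c) ∑w≡1 ⟩
    1ℚ *ℚ c                          ≡⟨ ℚP.*-identityˡ c ⟩
    c                                ∎
    where open ≡-Reasoning

module _ {m} {w : Fin m → ℚ} (w≥0 : ∀ x → 0ℚ ≤ℚ w x) where

  prodℚ-nonNeg : ∀ s → 0ℚ ≤ℚ prodℚ (map w s)
  prodℚ-nonNeg []      = ℚ.*≤* (ℤ.+≤+ z≤n)
  prodℚ-nonNeg (x ∷ s) = *-nonNeg (w≥0 x) (prodℚ-nonNeg s)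

  prodℚ-mono : ∀ {v : Fin m → ℚ} s → All (λ x → w x ≤ℚ v x) s → prodℚ (map w s) ≤ℚ prodℚ (map v s)
  prodℚ-mono []      []             = ℚP.≤-refl
  prodℚ-mono (x ∷ s) (wx≤vx ∷ w≤v) = ℚP.≤-trans (*-monoʳ-≤ (prodℚ-nonNeg s) wx≤vx)
    (*-monoˡ-≤ (ℚP.≤-trans (w≥0 x) wx≤vx) (prodℚ-mono s w≤v))

  𝔼-mono : ∀ q {F G} → (∀ s → F s ≤ℚ G s) → 𝔼 w q F ≤ℚ 𝔼 w q G
  𝔼-mono q F≤G = ∑ₗ-mono (λ s → *-monoˡ-≤ (prodℚ-nonNeg s) (F≤G s)) (seqs m q)

𝔼-map : ∀ {m n} (key : Fin m → Fin n) (w : Fin m → ℚ) (ν : Fin n → ℚ) →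
        (∀ g → ∑ (λ x → w x *ℚ g (key x)) ≡ ∑ (λ v → ν v *ℚ g v)) →
        ∀ q F → 𝔼 w q (F ∘ map key) ≡ 𝔼 ν q F
𝔼-map key w ν push zero    F = trans (𝔼-zero w (F ∘ map key)) (sym (𝔼-zero ν F))
𝔼-map key w ν push (suc q) F = begin
  𝔼 w (suc q) (F ∘ map key)
    ≡⟨ 𝔼-suc w q (F ∘ map key) ⟩
  ∑ (λ x → w x *ℚ 𝔼 w q (λ s → F (key x ∷ map key s)))
    ≡⟨ ∑ₗ-cong (λ x → cong (w x *ℚ_) (𝔼-map key w ν push q _)) (allFin _) ⟩
  ∑ (λ x → w x *ℚ 𝔼 ν q (λ t → F (key x ∷ t)))
    ≡⟨ push (λ v → 𝔼 ν q (λ t → F (v ∷ t))) ⟩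
  ∑ (λ v → ν v *ℚ 𝔼 ν q (λ t → F (v ∷ t)))
    ≡⟨ 𝔼-suc ν q F ⟨
  𝔼 ν (suc q) F ∎
  where open ≡-Reasoning

𝔼-coupling : ∀ {m} {w v : Fin m → ℚ} {F G : List (Fin m) → ℚ} (B : List (Fin m) → Bool) →
             (∀ x → 0ℚ ≤ℚ w x) → (∀ x → 0ℚ ≤ℚ v x) →
             (∀ s → F s ≤ℚ 1ℚ) → (∀ s → 0ℚ ≤ℚ G s) →
             (∀ s → B s ≡ false → F s ≡ G s × All (λ x → w x ≤ℚ v x) s) →
             ∀ q → 𝔼 w q F ≤ℚ 𝔼 v q G +ℚ 𝔼 w q (ind ∘ B)
𝔼-coupling {m} {w} {v} {F} {G} B w≥0 v≥0 F≤1 G≥0 agree q =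
  ℚP.≤-trans (∑ₗ-mono pointwise (seqs m q)) (ℚP.≤-reflexive (∑ₗ-+ _ _ (seqs m q)))
  where
  P Q : List (Fin m) → ℚ
  P s = prodℚ (map w s)
  Q s = prodℚ (map v s)
  pointwise : ∀ s → P s *ℚ F s ≤ℚ Q s *ℚ G s +ℚ P s *ℚ ind (B s)
  pointwise s with B s in Bs
  ... | true  = begin
    P s *ℚ F s                ≤⟨ *-monoˡ-≤ (prodℚ-nonNeg w≥0 s) (F≤1 s) ⟩
    P s *ℚ 1ℚ                 ≡⟨ ℚP.+-identityˡ _ ⟨
    0ℚ +ℚ P s *ℚ 1ℚ           ≤⟨ ℚP.+-monoˡ-≤ (P s *ℚ 1ℚ) (*-nonNeg (prodℚ-nonNeg v≥0 s) (G≥0 s)) ⟩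
    Q s *ℚ G s +ℚ P s *ℚ 1ℚ   ∎
    where open ℚP.≤-Reasoning
  ... | false with agree s Bs
  ...   | F≡G , w≤v = begin
    P s *ℚ F s                ≡⟨ cong (P s *ℚ_) F≡G ⟩
    P s *ℚ G s                ≤⟨ *-monoʳ-≤ (G≥0 s) (prodℚ-mono w≥0 s w≤v) ⟩
    Q s *ℚ G s                ≡⟨ ℚP.+-identityʳ _ ⟨
    Q s *ℚ G s +ℚ 0ℚ          ≡⟨ cong (Q s *ℚ G s +ℚ_) (ℚP.*-zeroʳ (P s)) ⟨
    Q s *ℚ G s +ℚ P s *ℚ 0ℚ   ∎
    where open ℚP.≤-Reasoning

hits : ∀ {n} → Fin n → List (Fin n) → Bool
hits y []      = false
hits y (x ∷ s) = does (x Fin.≟ y) ∨ hits y s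

repeats : ∀ {n} → List (Fin n) → Bool
repeats []      = false
repeats (x ∷ s) = hits x s ∨ repeats s

module Birthday {n} (ν : Fin n → ℚ) (ν≥0 : ∀ v → 0ℚ ≤ℚ ν v) (∑ν≡1 : ∑ ν ≡ 1ℚ) where

  collision : ℚ
  collision = ∑ (λ v → ν v *ℚ ν v)

  ∑-weight-+ : ∀ (f : Fin n → ℚ) c → ∑ (λ x → ν x *ℚ (f x +ℚ c)) ≡ ∑ (λ x → ν x *ℚ f x) +ℚ c
  ∑-weight-+ f c = begin
    ∑ (λ x → ν x *ℚ (f x +ℚ c))     ≡⟨ ∑ₗ-cong (λ x → ℚP.*-distribˡ-+ (ν x) (f x) c) (allFin n) ⟩
    ∑ (λ x → ν x *ℚ f x +ℚ ν x *ℚ c) ≡⟨ ∑ₗ-+ (λ x → ν x *ℚ f x) (λ x → ν x *ℚ c) (allFin n) ⟩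
    E +ℚ ∑ (λ x → ν x *ℚ c)          ≡⟨ cong (E +ℚ_) (∑ₗ-*ʳ c ν (allFin n)) ⟩
    E +ℚ ∑ ν *ℚ c                    ≡⟨ cong (λ t → E +ℚ t *ℚ c) ∑ν≡1 ⟩
    E +ℚ 1ℚ *ℚ c                     ≡⟨ cong (E +ℚ_) (ℚP.*-identityˡ c) ⟩
    E +ℚ c                           ∎
    where
    open ≡-Reasoning
    E = ∑ (λ x → ν x *ℚ f x)

  ∑-weight-mono : ∀ {f g : Fin n → ℚ} → (∀ x → f x ≤ℚ g x) →
                  ∑ (λ x → ν x *ℚ f x) ≤ℚ ∑ (λ x → ν x *ℚ g x)
  ∑-weight-mono f≤g = ∑ₗ-mono (λ x → *-monoˡ-≤ (ν≥0 x) (f≤g x)) (allFin n)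

  𝔼-∨ : ∀ q (a b : List (Fin n) → Bool) →
        𝔼 ν q (λ s → ind (a s ∨ b s)) ≤ℚ 𝔼 ν q (ind ∘ a) +ℚ 𝔼 ν q (ind ∘ b)
  𝔼-∨ q a b = ℚP.≤-trans (𝔼-mono ν≥0 q (λ s → ind-∨ (a s) (b s)))
    (ℚP.≤-reflexive (𝔼-+ ν q (ind ∘ a) (ind ∘ b)))

  𝔼-first-∨ : ∀ q a (b : List (Fin n) → Bool) →
              𝔼 ν q (λ s → ind (a ∨ b s)) ≤ℚ ind a +ℚ 𝔼 ν q (ind ∘ b)
  𝔼-first-∨ q a b = ℚP.≤-trans (𝔼-∨ q (λ _ → a) b)
    (ℚP.≤-reflexive (cong (_+ℚ 𝔼 ν q (ind ∘ b)) (𝔼-const ν ∑ν≡1 q (ind a))))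

  𝔼-hits : ∀ q y → 𝔼 ν q (ind ∘ hits y) ≤ℚ fromℕ q *ℚ ν y
  𝔼-hits zero    y = ℚP.≤-reflexive (trans (𝔼-zero ν (ind ∘ hits y)) (sym (ℚP.*-zeroˡ (ν y))))
  𝔼-hits (suc q) y = begin
    𝔼 ν (suc q) (ind ∘ hits y)
      ≡⟨ 𝔼-suc ν q (ind ∘ hits y) ⟩
    ∑ (λ x → ν x *ℚ 𝔼 ν q (λ s → ind (does (x Fin.≟ y) ∨ hits y s)))
      ≤⟨ ∑-weight-mono first-step ⟩
    ∑ (λ x → ν x *ℚ (ind (does (x Fin.≟ y)) +ℚ fromℕ q *ℚ ν y))
      ≡⟨ ∑-weight-+ (λ x → ind (does (x Fin.≟ y))) (fromℕ q *ℚ ν y) ⟩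
    ∑ (λ x → ν x *ℚ ind (does (x Fin.≟ y))) +ℚ fromℕ q *ℚ ν y
      ≡⟨ cong (_+ℚ fromℕ q *ℚ ν y) (∑-δ ν y) ⟩
    ν y +ℚ fromℕ q *ℚ ν y
      ≡⟨ factor (ν y) (fromℕ q) ⟩
    (fromℕ 1 +ℚ fromℕ q) *ℚ ν y
      ≡⟨ cong (_*ℚ ν y) (fromℕ-+ 1 q) ⟩
    fromℕ (suc q) *ℚ ν y ∎
    where
    open ℚP.≤-Reasoning
    first-step : ∀ x → 𝔼 ν q (λ s → ind (does (x Fin.≟ y) ∨ hits y s)) ≤ℚ
                       ind (does (x Fin.≟ y)) +ℚ fromℕ q *ℚ ν y
    first-step x =
      ℚP.≤-trans (𝔼-first-∨ q _ (hits y)) (ℚP.+-monoʳ-≤ (ind (does (x Fin.≟ y))) (𝔼-hits q y))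
    factor : ∀ a b → a +ℚ b *ℚ a ≡ (1ℚ +ℚ b) *ℚ a
    factor a b = trans (cong (_+ℚ b *ℚ a) (sym (ℚP.*-identityˡ a))) (sym (ℚP.*-distribʳ-+ a 1ℚ b))

  𝔼-repeats : ∀ q → 𝔼 ν q (ind ∘ repeats) ≤ℚ fromℕ (q * q) *ℚ collision
  𝔼-repeats zero    = ℚP.≤-reflexive (trans (𝔼-zero ν (ind ∘ repeats)) (sym (ℚP.*-zeroˡ collision)))
  𝔼-repeats (suc q) = begin
    𝔼 ν (suc q) (ind ∘ repeats)
      ≡⟨ 𝔼-suc ν q (ind ∘ repeats) ⟩
    ∑ (λ x → ν x *ℚ 𝔼 ν q (λ s → ind (hits x s ∨ repeats s)))
      ≤⟨ ∑-weight-mono first-step ⟩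
    ∑ (λ x → ν x *ℚ (fromℕ q *ℚ ν x +ℚ fromℕ (q * q) *ℚ collision))
      ≡⟨ ∑-weight-+ (λ x → fromℕ q *ℚ ν x) (fromℕ (q * q) *ℚ collision) ⟩
    ∑ (λ x → ν x *ℚ (fromℕ q *ℚ ν x)) +ℚ fromℕ (q * q) *ℚ collision
      ≡⟨ cong (_+ℚ fromℕ (q * q) *ℚ collision)
           (trans (∑ₗ-cong (λ x → *-left-swap (ν x) (fromℕ q) (ν x)) (allFin n))
                  (∑ₗ-*ˡ (fromℕ q) (λ x → ν x *ℚ ν x) (allFin n))) ⟩
    fromℕ q *ℚ collision +ℚ fromℕ (q * q) *ℚ collision
      ≡⟨ ℚP.*-distribʳ-+ collision (fromℕ q) (fromℕ (q * q)) ⟨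
    (fromℕ q +ℚ fromℕ (q * q)) *ℚ collision
      ≡⟨ cong (_*ℚ collision) (fromℕ-+ q (q * q)) ⟩
    fromℕ (q + q * q) *ℚ collision
      ≤⟨ *-monoʳ-≤ collision≥0 (fromℕ-mono-≤ (ℕP.m≤n+m (q + q * q) (suc q))) ⟩
    fromℕ (suc q + (q + q * q)) *ℚ collision
      ≡⟨ cong (λ k → fromℕ k *ℚ collision) (square-suc q) ⟩
    fromℕ (suc q * suc q) *ℚ collision ∎
    where
    open ℚP.≤-Reasoning
    first-step : ∀ x → 𝔼 ν q (λ s → ind (hits x s ∨ repeats s)) ≤ℚ
                       fromℕ q *ℚ ν x +ℚ fromℕ (q * q) *ℚ collision
    first-step x = ℚP.≤-trans (𝔼-∨ q (hits x) repeats) (ℚP.+-mono-≤ (𝔼-hits q x) (𝔼-repeats q))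
    square-suc : ∀ q → suc q + (q + q * q) ≡ suc q * suc q
    square-suc = solve-∀
    collision≥0 : 0ℚ ≤ℚ collision
    collision≥0 = ℚP.≤-trans (ℚP.≤-reflexive (sym (∑-*0 ν))) (∑-weight-mono ν≥0)

  𝔼-hits-or-repeats : ∀ q z → 𝔼 ν q (λ s → ind (hits z s ∨ repeats s)) ≤ℚ
                              fromℕ q *ℚ ν z +ℚ fromℕ (q * q) *ℚ collision
  𝔼-hits-or-repeats q z =
    ℚP.≤-trans (𝔼-∨ q (hits z) repeats) (ℚP.+-mono-≤ (𝔼-hits q z) (𝔼-repeats q))

∨≡false : ∀ a {b} → a ∨ b ≡ false → a ≡ false × b ≡ false
∨≡false false b≡false = refl , b≡false

does≡false⇒¬ : ∀ {A : Set} (a? : Dec A) → does a? ≡ false → ¬ A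
does≡false⇒¬ (no ¬a) refl = ¬a

hits≡false : ∀ {n} {y : Fin n} s → hits y s ≡ false → All (_≢ y) s
hits≡false []      refl = []
hits≡false {y = y} (x ∷ s) eq with ∨≡false (does (x Fin.≟ y)) eq
... | x≢y , rest = does≡false⇒¬ (x Fin.≟ y) x≢y ∷ hits≡false s rest

repeats≡false : ∀ {n} (s : List (Fin n)) → repeats s ≡ false → Unique s
repeats≡false []      refl = []
repeats≡false (x ∷ s) eq with ∨≡false (hits x s) eq
... | no-hit , rest = All.map ≢-sym (hits≡false s no-hit) ∷ repeats≡false s rest

fresh : ℕ → ℕ → List ℕ
fresh i zero    = []
fresh i (suc q) = i ∷ fresh (suc i) q

indexOf-∉ : ∀ {n} {v : Fin n} seen → v ∉ seen → indexOf v seen ≡ nothing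
indexOf-∉         []       v∉ = refl
indexOf-∉ {v = v} (w ∷ ws) v∉ with v Fin.≟ w
... | yes v≡w = ⊥-elim (v∉ (here v≡w))
... | no _ rewrite indexOf-∉ ws (v∉ ∘ there) = refl

labels-fresh : ∀ {n} (seen s : List (Fin n)) → Unique s → All (_∉ seen) s →
               labels seen s ≡ fresh (length seen) (length s)
labels-fresh seen []       []                 []              = refl
labels-fresh seen (v ∷ vs) (v≢vs ∷ unique-vs) (v∉seen ∷ vs∉seen) rewrite indexOf-∉ seen v∉seen =
  cong (length seen ∷_)
    (trans (labels-fresh (seen ∷ʳ v) vs unique-vs (All.zipWith ∉-∷ʳ (vs∉seen , v≢vs)))
           (cong (λ i → fresh i (length vs)) (trans (length-++ seen) (ℕP.+-comm (length seen) 1))))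
  where
  ∉-∷ʳ : ∀ {w} → w ∉ seen × v ≢ w → w ∉ seen ∷ʳ v
  ∉-∷ʳ (w∉seen , v≢w) w∈ with ∈-++⁻ seen w∈
  ... | inj₁ w∈seen      = w∉seen w∈seen
  ... | inj₂ (here refl) = v≢w refl

labels-unique : ∀ {n} (s : List (Fin n)) → Unique s → labels [] s ≡ fresh 0 (length s)
labels-unique s unique = labels-fresh [] s unique (All.tabulate (λ _ ()))

-- The numerical estimate

square-cancel-< : ∀ {m n} → m * m < n * n → m < n
square-cancel-< m²<n² = ℕP.≰⇒> (λ n≤m → ℕP.<⇒≱ m²<n² (ℕP.*-mono-≤ n≤m n≤m))

module Numerics {q d R M : ℕ} (few-queries : q * q * (d * d + R) * 64 < M * M) (M≤S : M ≤ d * d + R)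
  where

  open ℕP.≤-Reasoning

  S : ℕ
  S = d * d + R

  1≤M : 1 ≤ M
  1≤M = ℕP.≰⇒> (λ M≤0 → ℕP.n≮0 (subst (λ m → q * q * S * 64 < m * m) (ℕP.n≤0⇒n≡0 M≤0) few-queries))

  1≤S : 1 ≤ S
  1≤S = ℕP.≤-trans 1≤M M≤S

  8q<M : 8 * q < M
  8q<M = square-cancel-< (begin-strict
    8 * q * (8 * q) ≡⟨ scale q ⟩
    q * q * 1 * 64  ≤⟨ ℕP.*-monoˡ-≤ 64 (ℕP.*-monoʳ-≤ (q * q) 1≤S) ⟩
    q * q * S * 64  <⟨ few-queries ⟩
    M * M           ∎)
    where
    scale : ∀ q → 8 * q * (8 * q) ≡ q * q * 1 * 64
    scale = solve-∀

  8qd<M : 8 * q * d < M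
  8qd<M = square-cancel-< (begin-strict
    8 * q * d * (8 * q * d) ≡⟨ scale q d ⟩
    q * q * (d * d) * 64    ≤⟨ ℕP.*-monoˡ-≤ 64 (ℕP.*-monoʳ-≤ (q * q) (ℕP.m≤m+n (d * d) R)) ⟩
    q * q * S * 64          <⟨ few-queries ⟩
    M * M                   ∎)
    where
    scale : ∀ q d → 8 * q * d * (8 * q * d) ≡ q * q * (d * d) * 64
    scale = solve-∀

  bridge-term : q * suc d * 4 ≤ suc M
  bridge-term = ℕP.≤-trans (ℕP.<⇒≤ (ℕP.*-cancelˡ-< 2 _ _ (begin-strict
    2 * (q * suc d * 4)  ≡⟨ split q d ⟩
    8 * q * d + 8 * q    <⟨ ℕP.+-mono-< 8qd<M 8q<M ⟩
    M + M                ≡⟨ cong (_+_ M) (ℕP.+-identityʳ M) ⟨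
    2 * M                ∎))) (ℕP.n≤1+n M)
    where
    split : ∀ q d → 2 * (q * suc d * 4) ≡ 8 * q * d + 8 * q
    split = solve-∀

  collision-term : q * q * (suc d * suc d + R) * 12 ≤ suc M * suc M
  collision-term = ℕP.<⇒≤ (begin-strict
    q * q * (suc d * suc d + R) * 12              ≡⟨ expand q d R ⟩
    q * q * S * 12 + q * q * (d + d + 1) * 12     ≤⟨ ℕP.+-monoʳ-≤ (q * q * S * 12)
                                                       (ℕP.*-monoˡ-≤ 12 (ℕP.*-monoʳ-≤ (q * q) linear≤3S)) ⟩
    q * q * S * 12 + q * q * (S + S + S) * 12     ≡⟨ collect (q * q) S ⟩
    q * q * S * 48                                ≤⟨ ℕP.*-monoʳ-≤ (q * q * S) (ℕP.m≤m+n 48 16) ⟩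
    q * q * S * 64                                <⟨ few-queries ⟩
    M * M                                         ≤⟨ ℕP.*-mono-≤ (ℕP.n≤1+n M) (ℕP.n≤1+n M) ⟩
    suc M * suc M                                 ∎)
    where
    d≤S : d ≤ S
    d≤S = ℕP.≤-trans (m≤m*m d) (ℕP.m≤m+n (d * d) R)
    linear≤3S : d + d + 1 ≤ S + S + S
    linear≤3S = ℕP.+-mono-≤ (ℕP.+-mono-≤ d≤S d≤S) 1≤S
    expand : ∀ q d R →
             q * q * (suc d * suc d + R) * 12 ≡ q * q * (d * d + R) * 12 + q * q * (d + d + 1) * 12
    expand = solve-∀
    collect : ∀ Q S → Q * S * 12 + Q * (S + S + S) * 12 ≡ Q * S * 48
    collect = solve-∀

-- The doubled graph

_++ʷ_ : ∀ {n} {H : Graph n} {u v w} → Walk H u v → Walk H v w → Walk H u w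
here          ++ʷ q = q
step edge p   ++ʷ q = step edge (p ++ʷ q)

module Doubled {k : ℕ} (G : Graph (suc k)) where

  vertices : List (Fin (suc k))
  vertices = allFin (suc k)

  bridge : Fin (suc k) → Fin (suc k) → Bool
  bridge zero    zero    = true
  bridge zero    (suc _) = false
  bridge (suc _) _       = false

  bridge-sym : ∀ u v → bridge u v ≡ bridge v u
  bridge-sym zero    zero    = refl
  bridge-sym zero    (suc _) = refl
  bridge-sym (suc _) zero    = refl
  bridge-sym (suc _) (suc _) = refl

  sideAdj : Fin 2 → Fin 2 → Fin (suc k) → Fin (suc k) → Bool
  sideAdj zero       zero       = adj G
  sideAdj (suc zero) (suc zero) = adj G
  sideAdj zero       (suc zero) = bridge
  sideAdj (suc zero) zero       = bridge

  sideAdj-sym : ∀ i j u v → sideAdj i j u v ≡ sideAdj j i v u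
  sideAdj-sym zero       zero       = Graph.sym G
  sideAdj-sym (suc zero) (suc zero) = Graph.sym G
  sideAdj-sym zero       (suc zero) = bridge-sym
  sideAdj-sym (suc zero) zero       = bridge-sym

  sideAdj-diag : ∀ i u v → sideAdj i i u v ≡ adj G u v
  sideAdj-diag zero       u v = refl
  sideAdj-diag (suc zero) u v = refl

  side : Fin (2 * suc k) → Fin 2
  side x = proj₁ (remQuot {2} (suc k) x)

  key : Fin (2 * suc k) → Fin (suc k)
  key x = proj₂ (remQuot {2} (suc k) x)

  key-copy : ∀ i v → key (copy i v) ≡ v
  key-copy i v = cong proj₂ (remQuot-combine {k = suc k} i v)

  copy-side-key : ∀ x → copy (side x) (key x) ≡ x
  copy-side-key = combine-remQuot {2} (suc k)

  doubled : Graph (2 * suc k)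
  doubled = record
    { adj    = λ x y → sideAdj (side x) (side y) (key x) (key y)
    ; sym    = λ x y → sideAdj-sym (side x) (side y) (key x) (key y)
    ; irrefl = λ x → trans (sideAdj-diag (side x) (key x) (key x)) (irrefl G (key x))
    }

  adj-copy : ∀ i j u v → adj doubled (copy i u) (copy j v) ≡ sideAdj i j u v
  adj-copy i j u v = cong₂ (λ (i′ , u′) (j′ , v′) → sideAdj i′ j′ u′ v′)
    (remQuot-combine {k = suc k} i u) (remQuot-combine {k = suc k} j v)

  lift : ∀ i {u v} → Walk G u v → Walk doubled (copy i u) (copy i v)
  lift i here                      = here
  lift i (step {u} {w} edge walk) =
    step (subst T (sym (trans (adj-copy i i u w) (sideAdj-diag i u w))) edge) (lift i walk)

  cross : ∀ i j → Walk doubled (copy i zero) (copy j zero)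
  cross zero       zero       = here
  cross (suc zero) (suc zero) = here
  cross zero       (suc zero) = step (subst T (sym (adj-copy zero (suc zero) zero zero)) _) here
  cross (suc zero) zero       = step (subst T (sym (adj-copy (suc zero) zero zero zero)) _) here

  doubled-connected : Connected G → Connected doubled
  doubled-connected connected x y = subst₂ (Walk doubled) (copy-side-key x) (copy-side-key y)
    (lift (side x) (connected (key x) zero) ++ʷ
      (cross (side x) (side y) ++ʷ lift (side y) (connected zero (key y))))

  deg₂ : Fin (suc k) → ℕ
  deg₂ zero    = suc (deg G zero)
  deg₂ (suc v) = deg G (suc v)

  deg₂-off-bridge : ∀ v → v ≢ zero → deg₂ v ≡ deg G v
  deg₂-off-bridge zero    v≢0 = ⊥-elim (v≢0 refl)
  deg₂-off-bridge (suc v) _   = refl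

  deg-plus-bridge : ∀ u → deg G u + count (map (bridge u) vertices) ≡ deg₂ u
  deg-plus-bridge zero    = trans (cong (λ bs → deg G zero + count bs) (map-allFin-suc (bridge zero)))
    (trans (cong (λ c → deg G zero + suc c) (count-false (allFin k))) (ℕP.+-comm (deg G zero) 1))
  deg-plus-bridge (suc u) =
    trans (cong (_+_ (deg G (suc u))) (count-false vertices)) (ℕP.+-identityʳ _)

  deg-copy : ∀ i u → deg doubled (copy i u) ≡ deg₂ u
  deg-copy i u = begin
    deg doubled (copy i u)
      ≡⟨ count-copy (suc k) (adj doubled (copy i u)) ⟩
    count (map (adj doubled (copy i u) ∘ copy zero) vertices) +
    count (map (adj doubled (copy i u) ∘ copy (suc zero)) vertices)
      ≡⟨ cong₂ (λ xs ys → count xs + count ys) (map-cong (adj-copy i zero u) vertices)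
                                                (map-cong (adj-copy i (suc zero) u) vertices) ⟩
    count (map (sideAdj i zero u) vertices) + count (map (sideAdj i (suc zero) u) vertices)
      ≡⟨ by-side i ⟩
    deg₂ u ∎
    where
    open ≡-Reasoning
    by-side : ∀ i → count (map (sideAdj i zero u) vertices) + count (map (sideAdj i (suc zero) u) vertices) ≡ deg₂ u
    by-side zero       = deg-plus-bridge u
    by-side (suc zero) = trans (ℕP.+-comm _ (deg G u)) (deg-plus-bridge u)

  deg-doubled : ∀ x → deg doubled x ≡ deg₂ (key x)
  deg-doubled x = trans (cong (deg doubled) (sym (copy-side-key x))) (deg-copy (side x) (key x))

  sumℕ-deg₂ : sumℕ (map deg₂ vertices) ≡ suc (twoE G)
  sumℕ-deg₂ = trans (cong sumℕ (map-allFin-suc deg₂)) (cong suc (sym (cong sumℕ (map-allFin-suc (deg G)))))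

  twoE-doubled : twoE doubled ≡ suc (twoE G) + suc (twoE G)
  twoE-doubled = begin
    twoE doubled
      ≡⟨ sumℕ-copy (suc k) (deg doubled) ⟩
    sumℕ (map (deg doubled ∘ copy zero) vertices) + sumℕ (map (deg doubled ∘ copy (suc zero)) vertices)
      ≡⟨ cong₂ (λ xs ys → sumℕ xs + sumℕ ys) (map-cong (deg-copy zero) vertices)
                                              (map-cong (deg-copy (suc zero)) vertices) ⟩
    sumℕ (map deg₂ vertices) + sumℕ (map deg₂ vertices)
      ≡⟨ cong₂ _+_ sumℕ-deg₂ sumℕ-deg₂ ⟩
    suc (twoE G) + suc (twoE G) ∎
    where open ≡-Reasoning

  N : ℕ
  N = suc (twoE G)

  ν : Fin (suc k) → ℚ
  ν v = divℕ (deg₂ v) N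

  ν-nonNeg : ∀ v → 0ℚ ≤ℚ ν v
  ν-nonNeg v = divℕ-nonNeg (deg₂ v) N

  ∑ν≡1 : ∑ ν ≡ 1ℚ
  ∑ν≡1 = trans (∑ₗ-divℕ deg₂ (twoE G) vertices)
    (trans (cong (λ m → divℕ m N) sumℕ-deg₂) (divℕ-self (twoE G)))

  πG-copy : ∀ i v → πG doubled (copy i v) ≡ divℕ (deg₂ v) (N + N)
  πG-copy i v = cong₂ divℕ (trans (deg-doubled (copy i v)) (cong deg₂ (key-copy i v))) twoE-doubled

  πG-doubled-copies : ∀ v → πG doubled (copy zero v) +ℚ πG doubled (copy (suc zero) v) ≡ ν v
  πG-doubled-copies v = trans (cong₂ _+ℚ_ (πG-copy zero v) (πG-copy (suc zero) v))
    (trans (divℕ-+ (deg₂ v) (deg₂ v) _)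
           (divℕ-cong {deg₂ v + deg₂ v} {twoE G + N} {deg₂ v} {twoE G} (halve (deg₂ v) (twoE G))))
    where
    halve : ∀ d t → (d + d) * suc t ≡ d * suc (t + suc t)
    halve = solve-∀

  ∑-key : ∀ (w : Fin (2 * suc k) → ℚ) (g : Fin (suc k) → ℚ) →
          ∑ (λ x → w x *ℚ g (key x)) ≡ ∑ (λ v → (w (copy zero v) +ℚ w (copy (suc zero) v)) *ℚ g v)
  ∑-key w g = begin
    ∑ (λ x → w x *ℚ g (key x))
      ≡⟨ ∑-copy {suc k} (λ x → w x *ℚ g (key x)) ⟩
    ∑ (λ v → w₀ v *ℚ g (key (copy zero v))) +ℚ ∑ (λ v → w₁ v *ℚ g (key (copy (suc zero) v)))
      ≡⟨ cong₂ _+ℚ_ (∑ₗ-cong (λ v → cong (λ u → w₀ v *ℚ g u) (key-copy zero v)) vertices)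
                    (∑ₗ-cong (λ v → cong (λ u → w₁ v *ℚ g u) (key-copy (suc zero) v)) vertices) ⟩
    ∑ (λ v → w₀ v *ℚ g v) +ℚ ∑ (λ v → w₁ v *ℚ g v)
      ≡⟨ ∑ₗ-+ (λ v → w₀ v *ℚ g v) (λ v → w₁ v *ℚ g v) vertices ⟨
    ∑ (λ v → w₀ v *ℚ g v +ℚ w₁ v *ℚ g v)
      ≡⟨ ∑ₗ-cong (λ v → sym (ℚP.*-distribʳ-+ (g v) (w₀ v) (w₁ v))) vertices ⟩
    ∑ (λ v → (w₀ v +ℚ w₁ v) *ℚ g v) ∎
    where
    open ≡-Reasoning
    w₀ w₁ : Fin (suc k) → ℚ
    w₀ = w ∘ copy zero
    w₁ = w ∘ copy (suc zero)

  halfπ : Fin (2 * suc k) → ℚ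
  halfπ x = ½ *ℚ πG G (key x)

  halfπ-copies : ∀ v → halfπ (copy zero v) +ℚ halfπ (copy (suc zero) v) ≡ πG G v
  halfπ-copies v = begin
    ½ *ℚ πG G (key (copy zero v)) +ℚ ½ *ℚ πG G (key (copy (suc zero) v))
      ≡⟨ cong₂ (λ u u′ → ½ *ℚ πG G u +ℚ ½ *ℚ πG G u′) (key-copy zero v) (key-copy (suc zero) v) ⟩
    ½ *ℚ πG G v +ℚ ½ *ℚ πG G v
      ≡⟨ ℚP.*-distribʳ-+ (πG G v) ½ ½ ⟨
    (½ +ℚ ½) *ℚ πG G v
      ≡⟨ ℚP.*-identityˡ (πG G v) ⟩
    πG G v ∎
    where open ≡-Reasoning

  πG-doubled≤halfπ : ∀ {M} → twoE G ≡ suc M → ∀ x → key x ≢ zero → πG doubled x ≤ℚ halfπ x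
  πG-doubled≤halfπ {M} twoE≡ x off-bridge = begin
    πG doubled x
      ≡⟨ trans (cong (πG doubled) (sym (copy-side-key x))) (πG-copy (side x) (key x)) ⟩
    divℕ (deg₂ (key x)) (N + N)
      ≡⟨ cong₂ (λ d t → divℕ d (suc t + suc t)) (deg₂-off-bridge (key x) off-bridge) twoE≡ ⟩
    divℕ d (suc (suc M) + suc (suc M))
      ≤⟨ divℕ-mono-≤ {d} {suc M + suc (suc M)} {1 * d} {M + suc (M + 0)}
           (ℕP.*-mono-≤ (ℕP.≤-reflexive (sym (ℕP.*-identityˡ d)))
                        (ℕP.≤-trans (ℕP.m≤n+m _ 2) (ℕP.≤-reflexive (denominators M)))) ⟩
    divℕ (1 * d) (2 * suc M)
      ≡⟨ divℕ-* 1 1 d M ⟨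
    ½ *ℚ divℕ d (suc M)
      ≡⟨ cong (λ t → ½ *ℚ divℕ d t) twoE≡ ⟨
    halfπ x ∎
    where
    open ℚP.≤-Reasoning
    d = deg G (key x)
    denominators : ∀ M → 2 + suc (M + suc (M + 0)) ≡ suc (suc M + suc (suc M))
    denominators = solve-∀

  transcript-agrees : ∀ s → All (λ x → key x ≢ zero) s → Unique (map key s) →
                      transcript doubled s ≡ transcript G (map key s)
  transcript-agrees s off-bridge unique = cong₂ zip
    (trans (labels-unique s (Unique.map⁻ unique))
      (trans (cong (fresh 0) (sym (length-map key s))) (sym (labels-unique (map key s) unique))))
    (trans (map-cong-local (All.map (λ {x} off → trans (deg-doubled x) (deg₂-off-bridge (key x) off)) off-bridge))
      (map-∘ s))

  revealing : List (Fin (suc k)) → Bool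
  revealing s = hits zero s ∨ repeats s

  acceptProb-doubled : ∀ {M} → twoE G ≡ suc M → ∀ q A → ValidAlg A →
                       acceptProb doubled q A ≤ℚ acceptProb G q A +ℚ 𝔼 ν q (ind ∘ revealing)
  acceptProb-doubled twoE≡ q A valid = begin
    𝔼 (πG doubled) q (A ∘ transcript doubled)
      ≤⟨ 𝔼-coupling (revealing ∘ map key)
           (λ x → divℕ-nonNeg (deg doubled x) (twoE doubled))
           (λ x → *-nonNeg (divℕ-nonNeg 1 2) (divℕ-nonNeg (deg G (key x)) (twoE G)))
           (λ s → proj₂ (valid _)) (λ s → proj₁ (valid _)) agree q ⟩
    𝔼 halfπ q (A ∘ transcript G ∘ map key) +ℚ 𝔼 (πG doubled) q (ind ∘ revealing ∘ map key)
      ≡⟨ cong₂ _+ℚ_ (𝔼-map key halfπ (πG G) push-halfπ q (A ∘ transcript G))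
                    (𝔼-map key (πG doubled) ν push-πG q (ind ∘ revealing)) ⟩
    𝔼 (πG G) q (A ∘ transcript G) +ℚ 𝔼 ν q (ind ∘ revealing) ∎
    where
    open ℚP.≤-Reasoning
    push-halfπ : ∀ g → ∑ (λ x → halfπ x *ℚ g (key x)) ≡ ∑ (λ v → πG G v *ℚ g v)
    push-halfπ g = trans (∑-key halfπ g) (∑ₗ-cong (λ v → cong (_*ℚ g v) (halfπ-copies v)) vertices)
    push-πG : ∀ g → ∑ (λ x → πG doubled x *ℚ g (key x)) ≡ ∑ (λ v → ν v *ℚ g v)
    push-πG g = trans (∑-key (πG doubled) g) (∑ₗ-cong (λ v → cong (_*ℚ g v) (πG-doubled-copies v)) vertices)
    agree : ∀ s → revealing (map key s) ≡ false →
            A (transcript doubled s) ≡ A (transcript G (map key s)) × All (λ x → πG doubled x ≤ℚ halfπ x) s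
    agree s not-revealing with ∨≡false (hits zero (map key s)) not-revealing
    ... | no-bridge , no-repeat =
      cong A (transcript-agrees s off-bridge (repeats≡false (map key s) no-repeat)) ,
      All.map (λ {x} → πG-doubled≤halfπ twoE≡ x) off-bridge
      where
      off-bridge : All (λ x → key x ≢ zero) s
      off-bridge = All.map⁻ {f = key} (hits≡false (map key s) no-bridge)

  open Birthday ν ν-nonNeg ∑ν≡1

  d₀ R : ℕ
  d₀ = deg G zero
  R  = sumℕ (map (λ v → deg G (suc v) * deg G (suc v)) (allFin k))

  sumSqDeg≡ : sumSqDeg G ≡ d₀ * d₀ + R
  sumSqDeg≡ = cong sumℕ (map-allFin-suc (λ u → deg G u * deg G u))

  collision≡ : collision ≡ divℕ (suc d₀ * suc d₀ + R) (N * N)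
  collision≡ = begin
    ∑ (λ v → ν v *ℚ ν v)
      ≡⟨ ∑ₗ-cong (λ v → divℕ-* (deg₂ v) (twoE G) (deg₂ v) (twoE G)) vertices ⟩
    ∑ (λ v → divℕ (deg₂ v * deg₂ v) (N * N))
      ≡⟨ ∑ₗ-divℕ (λ v → deg₂ v * deg₂ v) (twoE G + twoE G * N) vertices ⟩
    divℕ (sumℕ (map (λ v → deg₂ v * deg₂ v) vertices)) (N * N)
      ≡⟨ cong (λ xs → divℕ (sumℕ xs) (N * N)) (map-allFin-suc (λ v → deg₂ v * deg₂ v)) ⟩
    divℕ (suc d₀ * suc d₀ + R) (N * N) ∎
    where open ≡-Reasoning

  revealing-bound : ∀ q → q * q * sumSqDeg G * 64 < twoE G * twoE G → 𝔼 ν q (ind ∘ revealing) ≤ℚ divℕ 1 3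
  revealing-bound q few-queries = begin
    𝔼 ν q (ind ∘ revealing)                          ≤⟨ 𝔼-hits-or-repeats q zero ⟩
    fromℕ q *ℚ ν zero +ℚ fromℕ (q * q) *ℚ collision  ≤⟨ ℚP.+-mono-≤ bridge-part collision-part ⟩
    divℕ 1 4 +ℚ divℕ 1 12                            ≡⟨⟩
    divℕ 1 3                                         ∎
    where
    open ℚP.≤-Reasoning
    open Numerics {q} {d₀} {R} {twoE G} (subst (λ S → q * q * S * 64 < twoE G * twoE G) sumSqDeg≡ few-queries)
                  (subst (twoE G ≤_) sumSqDeg≡ (twoE≤sumSqDeg G))
    bridge-part : fromℕ q *ℚ ν zero ≤ℚ divℕ 1 4
    bridge-part = ℚP.≤-trans (ℚP.≤-reflexive (fromℕ-*-divℕ q (suc d₀) (twoE G)))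
      (divℕ-mono-≤ {q * suc d₀} {twoE G} {1} {3} (subst (q * suc d₀ * 4 ≤_) (sym (ℕP.*-identityˡ N)) bridge-term))
    collision-part : fromℕ (q * q) *ℚ collision ≤ℚ divℕ 1 12
    collision-part = ℚP.≤-trans (ℚP.≤-reflexive (trans (cong (fromℕ (q * q) *ℚ_) collision≡)
        (fromℕ-*-divℕ (q * q) (suc d₀ * suc d₀ + R) (twoE G + twoE G * N))))
      (divℕ-mono-≤ {q * q * (suc d₀ * suc d₀ + R)} {twoE G + twoE G * N} {1} {11}
        (subst (q * q * (suc d₀ * suc d₀ + R) * 12 ≤_) (sym (ℕP.*-identityˡ (N * N))) collision-term))

successProb-≤ : ∀ {n m} (G : Graph n) (H : Graph m) q A →
                acceptProb H q A ≤ℚ acceptProb G q A +ℚ divℕ 1 3 → successProb G H q A ≤ℚ (+ 2) / 3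
successProb-≤ G H q A H≤G+⅓ = begin
  ½ *ℚ ((1ℚ -ℚ a) +ℚ acceptProb H q A)
    ≤⟨ *-monoˡ-≤ (divℕ-nonNeg 1 2) (ℚP.+-monoʳ-≤ (1ℚ -ℚ a) H≤G+⅓) ⟩
  ½ *ℚ ((1ℚ -ℚ a) +ℚ (a +ℚ divℕ 1 3))
    ≡⟨ cancel ½ a (divℕ 1 3) ⟩
  ½ *ℚ (1ℚ +ℚ divℕ 1 3)
    ≡⟨⟩
  (+ 2) / 3 ∎
  where
  open ℚP.≤-Reasoning
  a = acceptProb G q A
  cancel : ∀ h a t → h *ℚ ((1ℚ -ℚ a) +ℚ (a +ℚ t)) ≡ h *ℚ (1ℚ +ℚ t)
  cancel h a t = cong (h *ℚ_) (trans (sym (ℚP.+-assoc (1ℚ -ℚ a) a t)) (cong (_+ℚ t)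
    (trans (ℚP.+-assoc 1ℚ (ℚ.- a) a) (trans (cong (1ℚ +ℚ_) (ℚP.+-inverseˡ a)) (ℚP.+-identityʳ 1ℚ)))))

below-eighth : ∀ a m → fromℕ a <ℚ ((+ 1) / 8) *ℚ ((+ 1) / 8) *ℚ fromℕ m → a * 64 < m
below-eighth a m a<m/64 = subst (a * 64 <_) (trans (ℕP.*-identityʳ (1 * 1 * m)) (ℕP.*-identityˡ m))
  (divℕ-cancel-< {a} {0} {1 * 1 * m} {63}
    (subst (fromℕ a <ℚ_) (trans (cong (_*ℚ fromℕ m) (divℕ-* 1 7 1 7)) (divℕ-* (1 * 1) 63 m 0)) a<m/64))

suc-of-≤ : ∀ {m n} → suc m ≤ n → Σ ℕ (λ M → n ≡ suc M)
suc-of-≤ (s≤s _) = _ , refl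

lemma1 : Σ ℚ (λ c → (0ℚ <ℚ c) ×
           (∀ (n : ℕ) (G : Graph n) → Connected G → 2 * n ≤ twoE G →
             Σ (Graph (2 * n)) (λ G~ → Connected G~ ×
               (∀ (q : ℕ) → fromℕ (q * q * sumSqDeg G) <ℚ c *ℚ c *ℚ fromℕ (twoE G * twoE G) →
                 ∀ (A : Transcript → ℚ) → ValidAlg A →
                 successProb G G~ q A ≤ℚ (+ 2) / 3))))
lemma1 = (+ 1) / 8 , ℚP.positive⁻¹ _ , indistinguishable
  where
  indistinguishable : ∀ (n : ℕ) (G : Graph n) → Connected G → 2 * n ≤ twoE G →
    Σ (Graph (2 * n)) (λ G~ → Connected G~ ×
      (∀ (q : ℕ) → fromℕ (q * q * sumSqDeg G) <ℚ ((+ 1) / 8) *ℚ ((+ 1) / 8) *ℚ fromℕ (twoE G * twoE G) →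
        ∀ (A : Transcript → ℚ) → ValidAlg A → successProb G G~ q A ≤ℚ (+ 2) / 3))
  -- With no vertices twoE G = 0, so no q satisfies the query bound.
  indistinguishable zero    G connected _ = G , connected , λ q few-queries _ _ →
    ⊥-elim (ℕP.n≮0 (below-eighth (q * q * sumSqDeg G) 0 few-queries))
  indistinguishable (suc k) G connected 2n≤2E with suc-of-≤ 2n≤2E
  ... | _ , twoE≡ = doubled , doubled-connected connected , λ q few-queries A valid →
    successProb-≤ G doubled q A (ℚP.≤-trans (acceptProb-doubled twoE≡ q A valid)
      (ℚP.+-monoʳ-≤ (acceptProb G q A)
        (revealing-bound q (below-eighth (q * q * sumSqDeg G) (twoE G * twoE G) few-queries))))
    where
    open Doubled G
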